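{- For every integer $n\ge2$, $$n\,\mathbb{Z}^{o}_{\ge3}=n\Bigl(\mathbb{Z}^{o}_{\ge3}\setminus\bigl(\textstyle\bigsqcup_{i=1}^{n-1}\mathcal{C}^{(i)}_{>1}\bigr)\Bigr),$$ and $\bigsqcup_{i=1}^{n-1}\mathcal{C}^{(i)}_{>1}$ is an $n$-th sum-factor collapsed subset of $\mathbb{Z}^{o}_{\ge3}$.
   Context: $\mathbb{Z}^{o}_{\ge3}$ is the set of all odd integers $\ge3$; $\mathcal{P}_{\ge3}$ is the set of all odd primes; $\mathcal{C}^{o}_{>1}$ is the set of all odd composite positive integers. For a non-empty set $S$ of integers, $nS=\{s_1+\cdots+s_n: s_i\in S\}$ (the $n$-fold sumset), and $S+T=\{s+t:s\in S,t\in T\}$. The subsets $\mathcal{C}^{(i)}_{>1}$ of $\mathcal{C}^{o}_{>1}$ (pairwise disjoint) are defined inductively by $\mathcal{C}^{(1)}_{>1}=\{c\in\mathcal{C}^{o}_{>1}: 3+c\in2\mathcal{P}_{\ge3}\}$ and, for $k\ge2$, $\mathcal{C}^{(k)}_{>1}=\{c\in\mathcal{C}^{o}_{>1}\setminus\bigcup_{i=1}^{k-1}\mathcal{C}^{(i)}_{>1}: 3+c\in\mathcal{P}_{\ge3}+\mathcal{C}^{(k-1)}_{>1}\}$ (with the sumset empty if $\mathcal{C}^{(k-1)}_{>1}=\emptyset$). A subset $C\subset B$ (with $B$ a non-empty set of integers) is an $n$-th sum-factor collapsed subset of $B$ if $B\setminus C$ is non-empty, $nB=n(B\setminus C)$,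 and every $b\in B$ is a product $c_1\cdots c_k$ with $k\ge1$ and all $c_j\in B\setminus C$. -}

module Defs where

open import Data.Nat.Base as ℕ using (ℕ; zero; suc; z≤n; s≤s)
import Data.Nat.Properties as ℕ
open import Data.Nat.Primality using (Prime; Composite)
open import Data.Integer.Base using (ℤ; +_; _+_; _≤_)
open import Data.Integer.Divisibility using (_∣_)
open import Data.Integer.Properties using (+-0-monoid; *-1-monoid)
open import Algebra.Properties.Monoid.Sum +-0-monoid using (sum)
open import Algebra.Properties.Monoid.Sum *-1-monoid using () renaming (sum to product)
open import Data.Product.Base using (_×_; _,_; ∃-syntax; Σ-syntax)
open import Data.Sum.Base using (inj₁; inj₂)
open import Data.Vec.Functional using (Vector)
open import Function.Bundles using (_⇔_; mk⇔; module Equivalence)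
open import Level using (0ℓ)
open import Relation.Binary.PropositionalEquality using (_≡_; refl)
open import Relation.Nullary.Negation using (¬_)
open import Relation.Unary using (Pred; ∅; _∈_; _⊆_; _≐_; _∪_; _∖_; Satisfiable)

infixr 7 _·_
infixl 6 _⊕_

_·_ : ℕ → Pred ℤ 0ℓ → Pred ℤ 0ℓ
(n · S) z = Σ[ s ∈ Vector ℤ n ] (∀ i → s i ∈ S) × z ≡ sum s

_⊕_ : Pred ℤ 0ℓ → Pred ℤ 0ℓ → Pred ℤ 0ℓ
(S ⊕ T) z = ∃[ s ] ∃[ t ] (s ∈ S × t ∈ T × z ≡ s + t)

Odd : Pred ℤ 0ℓ
Odd z = ¬ (+ 2 ∣ z)

ℤᵒ≥3 : Pred ℤ 0ℓ
ℤᵒ≥3 z = Odd z × + 3 ≤ z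

𝒫≥3 : Pred ℤ 0ℓ
𝒫≥3 z = Odd z × ∃[ p ] (Prime p × z ≡ + p)

𝒞ᵒ>1 : Pred ℤ 0ℓ
𝒞ᵒ>1 z = Odd z × ∃[ c ] (Composite c × z ≡ + c)

-- 𝒞 k is 𝒞^(k) for k ≥ 1; the value at k = 0 is a dummy.  earlier k is the
-- union of 𝒞 1, …, 𝒞 k, written recursively so that the mutual definition is
-- structural; ∈-earlier⇔∈-⨆𝒞 identifies it with the indexed union ⨆𝒞< (suc k).
𝒞 earlier : ℕ → Pred ℤ 0ℓ

𝒞 zero            = ∅
𝒞 (suc zero)    c = c ∈ 𝒞ᵒ>1 × + 3 + c ∈ 2 · 𝒫≥3
𝒞 (suc (suc k)) c = c ∈ 𝒞ᵒ>1 ∖ earlier (suc k) × + 3 + c ∈ 𝒫≥3 ⊕ 𝒞 (suc k)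

earlier zero    = ∅
earlier (suc k) = earlier k ∪ 𝒞 (suc k)

⨆𝒞< : ℕ → Pred ℤ 0ℓ
⨆𝒞< n c = ∃[ i ] (1 ℕ.≤ i × i ℕ.< n × c ∈ 𝒞 i)

∈-earlier⇔∈-⨆𝒞 : ∀ k {c} → c ∈ earlier k ⇔ c ∈ ⨆𝒞< (suc k)
∈-earlier⇔∈-⨆𝒞 k = mk⇔ (to k) (λ (i , 1≤i , i<1+k , c∈) → from k i 1≤i (ℕ.s≤s⁻¹ i<1+k) c∈)
  where
  to : ∀ k {c} → c ∈ earlier k → c ∈ ⨆𝒞< (suc k)
  to (suc k) (inj₁ c∈) with to k c∈
  ... | i , 1≤i , i<k , c∈𝒞 = i , 1≤i , ℕ.m<n⇒m<1+n i<k , c∈𝒞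
  to (suc k) (inj₂ c∈) = suc k , s≤s z≤n , ℕ.≤-refl , c∈

  from : ∀ k {c} i → 1 ℕ.≤ i → i ℕ.≤ k → c ∈ 𝒞 i → c ∈ earlier k
  from zero    i 1≤i i≤0 c∈ with () ← ℕ.≤-trans 1≤i i≤0
  from (suc k) i 1≤i i≤k c∈ with ℕ.m≤n⇒m<n∨m≡n i≤k
  ... | inj₁ (s≤s i≤k′) = inj₁ (from k i 1≤i i≤k′ c∈)
  ... | inj₂ refl       = inj₂ c∈

-- The union ⨆𝒞< is disjoint.
𝒞-disjoint : ∀ {i j c} → 1 ℕ.≤ i → i ℕ.< j → c ∈ 𝒞 i → ¬ c ∈ 𝒞 j
𝒞-disjoint {i} {suc (suc k)} 1≤i i<j c∈𝒞ᵢ ((_ , c∉earlier) , _) =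
  c∉earlier (Equivalence.from (∈-earlier⇔∈-⨆𝒞 (suc k)) (i , 1≤i , i<j , c∈𝒞ᵢ))
𝒞-disjoint {j = suc zero} (s≤s _) (s≤s ()) _ _

-- Non-emptiness of B is not a separate field: it follows from remainder.
record IsSumFactorCollapsed (n : ℕ) (B C : Pred ℤ 0ℓ) : Set where
  field
    subset    : C ⊆ B
    remainder : Satisfiable (B ∖ C)
    sums      : n · B ≐ n · (B ∖ C)
    factors   : ∀ {b} → b ∈ B →
                ∃[ k ] (1 ℕ.≤ k × Σ[ c ∈ Vector ℤ k ] (∀ i → c i ∈ B ∖ C) × b ≡ product c)

{-# OPTIONS --safe #-}

-- Replacing summands s, t by 3, s + t − 3 repeatedly turns every sum of n odd
-- integers ≥ 3 into 3 + ⋯ + 3 + c with c odd and ≥ 3.  If c ∈ 𝒞 k for some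
-- k < n, then unfolding 𝒞 shows that k copies of 3 together with c make a sum
-- of k + 1 odd primes, and no prime lies in any 𝒞 i.  The case distinction on c
-- is constructive because every 𝒞 k is decidable by a finite search.
module Submission where

open import Defs
open import Data.Fin.Base using (zero; suc)
open import Data.Integer.Base as ℤ using (ℤ; +_; -[1+_]; _+_; _-_; _*_; ∣_∣; +≤+)
open import Data.Integer.DivMod using (_/ℕ_; _%ℕ_; n%ℕd<d; a≡a%ℕn+[a/ℕn]*n)
import Data.Integer.Divisibility.Signed as Signed
import Data.Integer.Properties as ℤ
open import Data.Integer.Properties using (*-1-monoid)
open import Data.Integer.Tactic.RingSolver using (solve-∀)
open import Algebra.Properties.Monoid.Sum *-1-monoid using () renaming (sum to product)
open import Data.List.Base using ([]; _∷_)
open import Data.List.Relation.Unary.All using (All; []; _∷_)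
open import Data.Nat.Base as ℕ using (ℕ; zero; suc; _≤_; z≤n; s≤s)
import Data.Nat.Divisibility as ℕ
open import Data.Nat.ListAction using () renaming (product to productⁿ)
open import Data.Nat.Primality
  using (Prime; prime?; composite?; prime⇒nonTrivial; composite⇒nonTrivial; composite⇒¬prime)
open import Data.Nat.Primality.Factorisation using (factorise)
import Data.Nat.Properties as ℕ
open import Data.Product.Base using (_×_; _,_; ∃-syntax; Σ-syntax; proj₁; proj₂)
open import Data.Sum.Base using (inj₁; inj₂)
import Data.Vec.Functional as Vector
open import Data.Vec.Functional using (Vector)
open import Function.Base using (_∘_)
open import Function.Bundles using (module Equivalence)
open import Level using (0ℓ)
open import Relation.Binary.PropositionalEquality using (_≡_; refl; sym; trans; cong; subst)
open import Relation.Nullary.Decidable using (yes; no; map′; _×-dec_; ¬?; from-yes)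
open import Relation.Nullary.Negation using (contradiction)
open import Relation.Unary using (Pred; Decidable; _∈_; _∉_; _⊆_; _≐_; _∖_)
open import Relation.Unary.Properties using (∅?; _∪?_)

private
  variable
    S T : Pred ℤ 0ℓ
    n : ℕ
    c s z : ℤ

-- Natural summands are bounded by their sum, which is what makes the search in `⊕?` finite.
Natural : Pred ℤ 0ℓ
Natural z = ∃[ n ] z ≡ + n

odd? : Decidable Odd
odd? z = ¬? (2 ℕ.∣? ∣ z ∣)

odd∧≥2⇒∈ℤᵒ≥3 : Odd (+ n) → 2 ≤ n → + n ∈ ℤᵒ≥3
odd∧≥2⇒∈ℤᵒ≥3 odd 2≤n =
  odd , +≤+ (ℕ.≤∧≢⇒< 2≤n λ { refl → odd ℕ.∣-refl })

odd⇒2∣z-3 : Odd z → + 2 Signed.∣ z - + 3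
odd⇒2∣z-3 {z} odd with z %ℕ 2 | n%ℕd<d z 2 | a≡a%ℕn+[a/ℕn]*n z 2
... | 0 | _ | eq = contradiction
  (Signed.∣⇒∣ᵤ (Signed.divides (z /ℕ 2) (trans eq (ℤ.+-identityˡ _)))) odd
... | 1 | _ | eq = Signed.divides (z /ℕ 2 - + 1) (trans (cong (_- + 3) eq) (rearrange (z /ℕ 2)))
  where
  rearrange : ∀ q → + 1 + q * + 2 - + 3 ≡ (q - + 1) * + 2
  rearrange = solve-∀
... | suc (suc _) | s≤s (s≤s ()) | _

-- The excess `s - + 3` is even and nonnegative, so adding it to `c` preserves both parity and the
-- lower bound.
ℤᵒ≥3-merge : s ∈ ℤᵒ≥3 → c ∈ ℤᵒ≥3 → (s - + 3) + c ∈ ℤᵒ≥3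
ℤᵒ≥3-merge {s} {c} (odd-s , 3≤s) (odd-c , 3≤c) =
  (λ 2∣ → odd-c (Signed.∣⇒∣ᵤ (Signed.∣m+n∣m⇒∣n {m = s - + 3}
    (Signed.∣ᵤ⇒∣ {i = (s - + 3) + c} 2∣) (odd⇒2∣z-3 {s} odd-s)))) ,
  ℤ.+-mono-≤ (ℤ.i≤j⇒0≤j-i 3≤s) 3≤c

𝒞ᵒ>1⊆ℤᵒ≥3 : 𝒞ᵒ>1 ⊆ ℤᵒ≥3
𝒞ᵒ>1⊆ℤᵒ≥3 (odd , n , composite , refl) =
  odd∧≥2⇒∈ℤᵒ≥3 odd (ℕ.nonTrivial⇒n>1 n {{composite⇒nonTrivial composite}})

𝒞⊆𝒞ᵒ>1 : ∀ k → 𝒞 k ⊆ 𝒞ᵒ>1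
𝒞⊆𝒞ᵒ>1 (suc zero)    = proj₁
𝒞⊆𝒞ᵒ>1 (suc (suc k)) = proj₁ ∘ proj₁

-- Every member of `𝒞 i` is composite. Both halves of the theorem rest on this: it lets sums and
-- products be sought among odd primes alone.
𝒫≥3⊆ℤᵒ≥3∖⨆𝒞< : 𝒫≥3 ⊆ ℤᵒ≥3 ∖ ⨆𝒞< n
𝒫≥3⊆ℤᵒ≥3∖⨆𝒞< (odd , p , prime-p , refl) =
  odd∧≥2⇒∈ℤᵒ≥3 odd (ℕ.nonTrivial⇒n>1 p {{prime⇒nonTrivial prime-p}}) , not-composite
  where
  not-composite : + p ∉ ⨆𝒞< _
  not-composite (i , _ , _ , p∈𝒞) with _ , _ , composite , refl ← 𝒞⊆𝒞ᵒ>1 i p∈𝒞 =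
    composite⇒¬prime composite prime-p

3∈𝒫≥3 : + 3 ∈ 𝒫≥3
3∈𝒫≥3 = from-yes (odd? (+ 3)) , 3 , from-yes (prime? 3) , refl

𝒫≥3? : Decidable 𝒫≥3
𝒫≥3? -[1+ _ ] = no λ { (_ , _ , _ , ()) }
𝒫≥3? (+ p)    = odd? (+ p) ×-dec
  map′ (λ prime-p → p , prime-p , refl) (λ { (_ , prime-p , refl) → prime-p }) (prime? p)

𝒞ᵒ>1? : Decidable 𝒞ᵒ>1
𝒞ᵒ>1? -[1+ _ ] = no λ { (_ , _ , _ , ()) }
𝒞ᵒ>1? (+ c)    = odd? (+ c) ×-dec
  map′ (λ composite → c , composite , refl) (λ { (_ , composite , refl) → composite }) (composite? c)

𝒫≥3-natural : 𝒫≥3 ⊆ Natural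
𝒫≥3-natural (_ , p , _ , eq) = p , eq

𝒞-natural : ∀ k → 𝒞 k ⊆ Natural
𝒞-natural k c∈ with _ , c , _ , eq ← 𝒞⊆𝒞ᵒ>1 k c∈ = c , eq

⊕? : S ⊆ Natural → T ⊆ Natural → Decidable S → Decidable T → Decidable (S ⊕ T)
⊕? {S} {T} S⊆ T⊆ S? T? z =
  -- The second summand is determined by the first, `+ m`, and `m` is at most `∣ z ∣`; the search
  -- bound is strict, hence `suc`.
  map′ to from (ℕ.anyUpTo? (λ m → S? (+ m) ×-dec T? (z - + m)) (suc ∣ z ∣))
  where
  to : (∃[ m ] (m ℕ.< suc ∣ z ∣ × S (+ m) × T (z - + m))) → z ∈ S ⊕ T
  to (m , _ , m∈ , z-m∈) = + m , z - + m , m∈ , z-m∈ , z≡m+[z-m] z (+ m)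
    where
    z≡m+[z-m] : ∀ z m → z ≡ m + (z - m)
    z≡m+[z-m] = solve-∀
  from : z ∈ S ⊕ T → ∃[ m ] (m ℕ.< suc ∣ z ∣ × S (+ m) × T (z - + m))
  from (s , t , s∈ , t∈ , refl) with m , refl ← S⊆ s∈ | n , refl ← T⊆ t∈ =
    m , s≤s (ℕ.m≤m+n m n) , s∈ , subst T (t≡s+t-s (+ m) (+ n)) t∈
    where
    t≡s+t-s : ∀ s t → t ≡ s + t - s
    t≡s+t-s = solve-∀

-- Lets `⊕?` also decide the condition defining `𝒞 1`, which is phrased with `2 ·`.
⊕≐2· : S ⊕ S ≐ 2 · S
⊕≐2· {S} = to , from
  where
  to : S ⊕ S ⊆ 2 · S
  to (s , t , s∈ , t∈ , refl) =
    s Vector.∷ t Vector.∷ Vector.[] , (λ { zero → s∈ ; (suc zero) → t∈ }) ,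
    cong (_+_ s) (sym (ℤ.+-identityʳ t))
  from : 2 · S ⊆ S ⊕ S
  from (v , v∈ , refl) =
    v zero , v (suc zero) , v∈ zero , v∈ (suc zero) , cong (_+_ (v zero)) (ℤ.+-identityʳ _)

𝒞? : ∀ k → Decidable (𝒞 k)
earlier? : ∀ k → Decidable (earlier k)

𝒞? zero            = ∅?
𝒞? (suc zero)    c = 𝒞ᵒ>1? c ×-dec
  map′ (proj₁ ⊕≐2·) (proj₂ ⊕≐2·) (⊕? 𝒫≥3-natural 𝒫≥3-natural 𝒫≥3? 𝒫≥3? (+ 3 + c))
𝒞? (suc (suc k)) c = (𝒞ᵒ>1? c ×-dec ¬? (earlier? (suc k) c)) ×-dec
  ⊕? 𝒫≥3-natural (𝒞-natural (suc k)) 𝒫≥3? (𝒞? (suc k)) (+ 3 + c)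

earlier? zero    = ∅?
earlier? (suc k) = earlier? k ∪? 𝒞? (suc k)

·-cons : ∀ S {s} → s ∈ S → z ∈ n · S → s + z ∈ suc n · S
·-cons S {s} s∈ (v , v∈ , refl) = s Vector.∷ v , (λ { zero → s∈ ; (suc i) → v∈ i }) , refl

·-mono : ∀ S T → S ⊆ T → n · S ⊆ n · T
·-mono S T S⊆T (v , v∈ , eq) = v , (λ i → S⊆T (v∈ i)) , eq

·-cons-3 : ∀ S c m → + 3 ∈ S → + (m ℕ.* 3) + c ∈ n · S → + (suc m ℕ.* 3) + c ∈ suc n · S
·-cons-3 {n} S c m 3∈ z∈ =
  -- `+ (suc m ℕ.* 3)` computes to `+ 3 + + (m ℕ.* 3)`, so only reassociation remains.
  subst (suc n · S) (sym (ℤ.+-assoc (+ 3) (+ (m ℕ.* 3)) c)) (·-cons S {+ 3} 3∈ z∈)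

·-3s-and : ∀ S c m → + 3 ∈ S → c ∈ S → + (m ℕ.* 3) + c ∈ suc m · S
·-3s-and S c zero 3∈ c∈ =
  subst (1 · S) (ℤ.+-comm c (+ 0)) (·-cons S {c} c∈ (Vector.[] , (λ ()) , refl))
·-3s-and S c (suc m) 3∈ c∈ = ·-cons-3 S c m 3∈ (·-3s-and S c m 3∈ c∈)

-- Induction from the right: the tail yields 3s and some `c`, then the head is replaced by 3 and its
-- excess over 3 moves into `c`.
·ℤᵒ≥3⇒3s-and : ∀ m → z ∈ suc m · ℤᵒ≥3 → ∃[ c ] (c ∈ ℤᵒ≥3 × z ≡ + (m ℕ.* 3) + c)
·ℤᵒ≥3⇒3s-and zero (v , v∈ , refl) = v zero , v∈ zero , ℤ.+-comm (v zero) (+ 0)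
·ℤᵒ≥3⇒3s-and (suc m) (v , v∈ , refl)
  with c , c∈ , eq ← ·ℤᵒ≥3⇒3s-and m (v ∘ suc , v∈ ∘ suc , refl) =
  (v zero - + 3) + c , ℤᵒ≥3-merge (v∈ zero) c∈ ,
  trans (cong (_+_ (v zero)) eq) (rearrange (v zero) (+ (m ℕ.* 3)) c)
  where
  rearrange : ∀ s t c → s + (t + c) ≡ (+ 3 + t) + ((s - + 3) + c)
  rearrange = solve-∀

-- For `k = 1` this is the defining condition. Otherwise one of the 3s is spent on `3 + c = p + c′`,
-- which splits off the prime `p` and leaves `c′` in the previous class with one 3 fewer.
𝒞⇒·𝒫≥3 : ∀ k → c ∈ 𝒞 k → + (k ℕ.* 3) + c ∈ suc k · 𝒫≥3
𝒞⇒·𝒫≥3 (suc zero) (_ , 3+c∈) = 3+c∈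
𝒞⇒·𝒫≥3 {c} (suc (suc k)) (_ , p , c′ , p∈ , c′∈ , 3+c≡p+c′) =
  subst (suc (suc (suc k)) · 𝒫≥3) eq (·-cons 𝒫≥3 {p} p∈ (𝒞⇒·𝒫≥3 (suc k) c′∈))
  where
  t = + (suc k ℕ.* 3)
  swap : ∀ a b c → a + (b + c) ≡ b + (a + c)
  swap = solve-∀
  swap′ : ∀ a b c → b + (a + c) ≡ (a + b) + c
  swap′ = solve-∀
  eq : p + (t + c′) ≡ + (suc (suc k) ℕ.* 3) + c
  eq = trans (swap p t c′) (trans (cong (_+_ t) (sym 3+c≡p+c′)) (swap′ (+ 3) t c))

-- A smaller index gives a shorter sum of primes; the missing summands are filled with 3, itself an
-- odd prime.
earlier⇒·𝒫≥3 : ∀ k → c ∈ earlier k → + (k ℕ.* 3) + c ∈ suc k · 𝒫≥3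
earlier⇒·𝒫≥3 {c} (suc k) (inj₁ c∈) = ·-cons-3 𝒫≥3 c k 3∈𝒫≥3 (earlier⇒·𝒫≥3 k c∈)
earlier⇒·𝒫≥3 (suc k) (inj₂ c∈) = 𝒞⇒·𝒫≥3 (suc k) c∈

·ℤᵒ≥3≐·ℤᵒ≥3∖⨆𝒞< : ∀ m → suc m · ℤᵒ≥3 ≐ suc m · (ℤᵒ≥3 ∖ ⨆𝒞< (suc m))
·ℤᵒ≥3≐·ℤᵒ≥3∖⨆𝒞< m = to , ·-mono (ℤᵒ≥3 ∖ ⨆𝒞< (suc m)) ℤᵒ≥3 proj₁
  where
  to : suc m · ℤᵒ≥3 ⊆ suc m · (ℤᵒ≥3 ∖ ⨆𝒞< (suc m))
  to z∈ with c , c∈ , refl ← ·ℤᵒ≥3⇒3s-and m z∈ | earlier? m c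
  -- Here `c` is forbidden, so the whole sum is rewritten with prime summands.
  ... | yes c∈earlier = ·-mono 𝒫≥3 (ℤᵒ≥3 ∖ ⨆𝒞< (suc m)) 𝒫≥3⊆ℤᵒ≥3∖⨆𝒞< (earlier⇒·𝒫≥3 m c∈earlier)
  -- Here `c` itself is allowed, and so is 3, so the normal form already serves.
  ... | no  c∉earlier = ·-3s-and (ℤᵒ≥3 ∖ ⨆𝒞< (suc m)) c m (𝒫≥3⊆ℤᵒ≥3∖⨆𝒞< 3∈𝒫≥3)
    (c∈ , c∉earlier ∘ Equivalence.from (∈-earlier⇔∈-⨆𝒞 m))

-- An even factor would make the product even, so oddness passes to each prime.
product-of-odd-primes : ∀ ps → All Prime ps → Odd (+ productⁿ ps) →
  ∃[ k ] Σ[ v ∈ Vector ℤ k ] (∀ i → v i ∈ 𝒫≥3) × + productⁿ ps ≡ product v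
product-of-odd-primes []       []             odd = 0 , Vector.[] , (λ ()) , refl
product-of-odd-primes (p ∷ ps) (prime-p ∷ primes) odd
  with k , v , v∈ , eq ← product-of-odd-primes ps primes (odd ∘ ℕ.∣n⇒∣m*n p) =
  suc k , + p Vector.∷ v ,
  (λ { zero → odd ∘ ℕ.∣m⇒∣m*n (productⁿ ps) , p , prime-p , refl ; (suc i) → v∈ i }) ,
  trans (ℤ.pos-* p (productⁿ ps)) (cong (_*_ (+ p)) eq)

ℤᵒ≥3⇒product-of-𝒫≥3 : z ∈ ℤᵒ≥3 →
  ∃[ k ] (1 ≤ k × Σ[ v ∈ Vector ℤ k ] (∀ i → v i ∈ 𝒫≥3) × z ≡ product v)
ℤᵒ≥3⇒product-of-𝒫≥3 {+ suc n} (odd , 3≤z)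
  with record { factors = ps ; isFactorisation = eq ; factorsPrime = primes } ← factorise (suc n)
  with product-of-odd-primes ps primes (subst (Odd ∘ +_) eq odd)
... | suc k , v , v∈ , ps≡v = suc k , s≤s z≤n , v , v∈ , trans (cong +_ eq) ps≡v
-- An empty factorisation has product 1, against `+ 3 ≤ z`.
... | zero  , v , v∈ , ps≡1
  with +≤+ (s≤s ()) ← subst (+ 3 ℤ.≤_) (trans (cong +_ eq) ps≡1) 3≤z
ℤᵒ≥3⇒product-of-𝒫≥3 {+ zero} (_ , +≤+ ())

theorem3p15 : (n : ℕ) → 2 ≤ n →
    (n · ℤᵒ≥3 ≐ n · (ℤᵒ≥3 ∖ ⨆𝒞< n)) × IsSumFactorCollapsed n ℤᵒ≥3 (⨆𝒞< n)
theorem3p15 (suc m) _ = ·ℤᵒ≥3≐·ℤᵒ≥3∖⨆𝒞< m , record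
  { subset    = λ (i , _ , _ , c∈) → 𝒞ᵒ>1⊆ℤᵒ≥3 (𝒞⊆𝒞ᵒ>1 i c∈)
  ; remainder = + 3 , 𝒫≥3⊆ℤᵒ≥3∖⨆𝒞< 3∈𝒫≥3
  ; sums      = ·ℤᵒ≥3≐·ℤᵒ≥3∖⨆𝒞< m
  ; factors   = λ b∈ → let k , 1≤k , v , v∈ , eq = ℤᵒ≥3⇒product-of-𝒫≥3 b∈
                       in k , 1≤k , v , (λ i → 𝒫≥3⊆ℤᵒ≥3∖⨆𝒞< (v∈ i)) , eq
  }
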